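{- Let $v\ge4$ be an integer with $v\not\equiv 2\pmod 4$. Then an optimum $(d,2)$-CDA$((d+1)v^2;6,v)$ exists for every positive integer $d$ with $d+1\le v$.
   Context: Consecutive $t$-way interaction in an $N\times k$ array $A=(a_{ij})$ over a $v$-set $V$: $T=\{(i,x_i),\dots,(i+t-1,x_{i+t-1})\}$, $1\le i\le k-t+1$, $x_r\in V$; $\rho(A,T)=\{r: a_{r,j}=x_j\ \forall (j,x_j)\in T\}$, $\rho(A,\mathcal T)=\bigcup_{T\in\mathcal T}\rho(A,T)$. A $(d,t)$-CDA$(N;k,v)$ is an $N\times k$ array over $V$ in which every $t$ consecutive columns contain every $t$-tuple at least once, and such that for every set $\mathcal T$ of exactly $d$ distinct consecutive $t$-way interactions and every consecutive $t$-way interaction $T$: $\rho(A,T)\subseteq\rho(A,\mathcal T)$ iff $T\in\mathcal T$. It is optimum if $N=(d+1)v^t$. -}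

module Defs where

open import Data.Nat using (ℕ; suc; _+_; _*_; _∸_; _^_; _≤_; _<_)
open import Data.Nat.Properties using (m∸n≢0⇒n<m; m∸n+n≡m; +-mono-≤; +-suc; ≤-pred; <⇒≤; m<n⇒n≢0; module ≤-Reasoning)
open import Data.Fin using (Fin; toℕ; fromℕ<)
open import Data.Fin.Properties using (toℕ<n)
open import Data.Vec using (Vec; lookup)
open import Data.List using (List; length)
open import Data.List.Relation.Unary.Any using (Any)
open import Data.List.Relation.Unary.Unique.Propositional using (Unique)
import Data.List.Membership.Propositional as List
open import Data.Product using (_×_)
open import Function.Bundles using (_⇔_)
open import Level using (0ℓ)
open import Relation.Unary using (Pred; _⊆_; Satisfiable)
open import Relation.Binary.PropositionalEquality using (_≡_; cong)

Array : (N k v : ℕ) → Set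
Array N k v = Fin N → Fin k → Fin v

-- The interaction {(i , x_i) , … , (i+t-1 , x_{i+t-1})} is stored as its first
-- column and its vector of values.  Columns are counted from 0, so the range
-- 1 ≤ i ≤ k-t+1 becomes Fin (suc k ∸ t), which is empty when t > k.
record Interaction (t k v : ℕ) : Set where
  constructor interaction
  field
    start  : Fin (suc k ∸ t)
    values : Vec (Fin v) t

open Interaction public

start+offset<k : ∀ {t k} (i : Fin (suc k ∸ t)) (s : Fin t) → toℕ i + toℕ s < k
start+offset<k {t} {k} i s = ≤-pred (begin
  suc (suc (toℕ i + toℕ s)) ≡⟨ cong suc (+-suc (toℕ i) (toℕ s)) ⟨
  suc (toℕ i) + suc (toℕ s) ≤⟨ +-mono-≤ (toℕ<n i) (toℕ<n s) ⟩
  (suc k ∸ t) + t           ≡⟨ m∸n+n≡m t≤1+k ⟩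
  suc k                     ∎)
  where
  open ≤-Reasoning
  t≤1+k : t ≤ suc k
  t≤1+k = <⇒≤ (m∸n≢0⇒n<m (m<n⇒n≢0 (toℕ<n i)))

column : ∀ {t k} → Fin (suc k ∸ t) → Fin t → Fin k
column i s = fromℕ< (start+offset<k i s)

ρ : ∀ {t N k v} → Array N k v → Interaction t k v → Pred (Fin N) 0ℓ
ρ A T r = ∀ s → A r (column (start T) s) ≡ lookup (values T) s

ρ⋃ : ∀ {t N k v} → Array N k v → List (Interaction t k v) → Pred (Fin N) 0ℓ
ρ⋃ A 𝒯 r = Any (λ T → ρ A T r) 𝒯

-- A set of exactly d interactions is a duplicate-free list of length d.
record IsCDA (d t : ℕ) {N k v : ℕ} (A : Array N k v) : Set where
  field
    covering  : (T : Interaction t k v) → Satisfiable (ρ A T)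
    detecting : (𝒯 : List (Interaction t k v)) → Unique 𝒯 → length 𝒯 ≡ d →
                (T : Interaction t k v) → (ρ A T ⊆ ρ⋃ A 𝒯) ⇔ (T List.∈ 𝒯)

IsOptimumCDA : (d t : ℕ) {N k v : ℕ} → Array N k v → Set
IsOptimumCDA d t {N} {k} {v} A = IsCDA d t A × N ≡ (d + 1) * v ^ t

{-# OPTIONS --safe #-}
module Submission where

-- Let L and M be orthogonal Latin squares of order v; they exist by MacNeish's
-- product, starting from b + c, b + 2c modulo an odd number and from b + c, b + xc
-- over the fields of order 4 and 8.  Take the v² rows
--   (a , b , L(a,c) , L(b,c) , a , M(b,c))
-- for each of d + 1 values of c.  For a fixed c, two adjacent columns contain every
-- pair once, so every interaction lies in d + 1 rows, one for each c.  Two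
-- interactions in different columns share at most one of these rows, because their
-- entries determine c.  So d other interactions cannot cover all rows of T.

open import Defs
open import Data.Nat using (ℕ; _+_; _*_; _^_; _≤_)
open import Data.Nat.DivMod using (_%_)
open import Data.Product using (Σ)
open import Relation.Binary.PropositionalEquality using (_≢_)

import Data.Fin as Fin
open import Data.Fin using (Fin; zero; suc; toℕ; #_; inject≤; combine; remQuot; quotient; remainder)
open import Data.Fin.Properties using (_≟_; <-cmp; all?; any?; pigeonhole; <⇒≢; toℕ<n; toℕ-injective; toℕ-fromℕ<; inject≤-injective; combine-injective; combine-remQuot; remQuot-combine)
import Data.List as List
open import Data.List using (length)
open import Data.List.Membership.Propositional using (_∈_)
open import Data.List.Membership.Propositional.Properties using (∈-lookup)
import Data.List.Relation.Unary.Any as Any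
open import Data.List.Relation.Unary.Any.Properties using (lookup-index)
open import Data.Nat using (zero; suc; NonZero; _<_; z<s; s<s)
open import Data.Nat.DivMod using (_/_; _mod_; m≡m%n+[m/n]*n; m%n%n≡m%n; [m+kn]%n≡m%n; m<n⇒m%n≡m; m%n<n; %-distribˡ-+; %-distribˡ-*)
open import Data.Nat.Induction using (<-rec)
import Data.Nat.Properties as ℕ
open import Data.Nat.Properties using (m<m+n; m<m*n; *-comm; *-identityˡ)
open import Data.Nat.Tactic.RingSolver using (solve-∀)
open import Data.Product using (_×_; _,_; ∃; ∃₂; proj₁; proj₂; map₂)
open import Data.Vec using (Vec; lookup; []; _∷_)
open import Data.Vec.Relation.Binary.Pointwise.Extensional using (ext; Pointwise-≡⇒≡)
open import Function.Base using (_∘_; case_of_)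
open import Function.Bundles using (mk⇔)
open import Relation.Binary.Definitions using (tri<; tri≈; tri>)
open import Relation.Binary.PropositionalEquality using (_≡_; refl; sym; trans; cong; cong₂; cong-app; subst; subst₂; module ≡-Reasoning)
open import Relation.Nullary using (yes; no; contradiction)
open import Relation.Nullary.Decidable using (from-yes; _→-dec_)
open import Relation.Unary using (_⊆_)

-- Arrays from rows with controlled overlaps

interaction-≡ : ∀ {t k v} {T T′ : Interaction t k v} → start T ≡ start T′ →
                (∀ s → lookup (values T) s ≡ lookup (values T′) s) → T ≡ T′
interaction-≡ refl eq = cong (interaction _) (Pointwise-≡⇒≡ (ext eq))

-- d interactions other than T cover at most d of the d + 1 listed rows of T.
isCDA : ∀ {d t N k v} (A : Array N k v)
        (rows : Interaction t k v → Fin (d + 1) → Fin N) →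
        (∀ T i → ρ A T (rows T i)) →
        (∀ T T′ i j → start T ≢ start T′ →
          ρ A T′ (rows T i) → ρ A T′ (rows T j) → i ≡ j) →
        IsCDA d t A
isCDA {d} {t} {N} {k} {v} A rows rows-ρ separated = record
  { covering  = λ T → rows T (first d) , rows-ρ T (first d)
  ; detecting = λ 𝒯 _ len T → mk⇔ (detect 𝒯 len T) (λ T∈𝒯 ρT → Any.map (λ { refl → ρT }) T∈𝒯)
  }
  where
  -- `d + 1` computes to a successor only once `d` is a constructor, hence the case split.
  first : ∀ d → Fin (d + 1)
  first zero    = zero
  first (suc _) = zero

  detect : ∀ 𝒯 → length 𝒯 ≡ d → ∀ T → ρ A T ⊆ ρ⋃ A 𝒯 → T ∈ 𝒯
  -- Each of the `d + 1` rows of `T` picks a position in `𝒯`; there are only `d` positions, so two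
  -- rows pick the same one.
  detect 𝒯 len T ρT⊆ρ𝒯 = locate (pigeonhole (subst (_< d + 1) (sym len) (m<m+n d z<s)) (Any.index ∘ hit))
    where
    hit : ∀ i → ρ⋃ A 𝒯 (rows T i)
    hit i = ρT⊆ρ𝒯 (rows-ρ T i)

    locate : (∃₂ λ i j → i Fin.< j × Any.index (hit i) ≡ Any.index (hit j)) → T ∈ 𝒯
    -- With equal starts, `T` and `T′` read the same values off row i, so they coincide. With
    -- different starts, `separated` would make i and j equal.
    locate (i , j , i<j , same) = case start T ≟ start T′ of λ where
        (yes eq) → subst (_∈ 𝒯) (sym (interaction-≡ eq (values-≡ eq))) (∈-lookup (Any.index (hit i)))
        (no neq) → contradiction (separated T T′ i j neq ρT′ᵢ ρT′ⱼ) (<⇒≢ i<j)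
      where
      T′ : Interaction t k v
      T′ = List.lookup 𝒯 (Any.index (hit i))

      ρT′ᵢ : ρ A T′ (rows T i)
      ρT′ᵢ = lookup-index (hit i)

      ρT′ⱼ : ρ A T′ (rows T j)
      ρT′ⱼ = subst (λ x → ρ A (List.lookup 𝒯 x) (rows T j)) (sym same) (lookup-index (hit j))

      values-≡ : start T ≡ start T′ → ∀ s → lookup (values T) s ≡ lookup (values T′) s
      values-≡ eq s = trans (sym (rows-ρ T i s))
                            (trans (cong (λ x → A (rows T i) (column x s)) eq) (ρT′ᵢ s))

-- Orthogonal Latin squares

Square : ℕ → Set
Square v = Fin v → Fin v → Fin v

-- On a finite set these two conditions make all rows and columns bijective.
record IsLatin {v} (L : Square v) : Set where
  constructor latin
  field
    row-injective     : ∀ b c c′ → L b c ≡ L b c′ → c ≡ c′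
    column-surjective : ∀ c y → ∃ λ b → L b c ≡ y

open IsLatin

row-injective-cong : ∀ {v} {L : Square v} → IsLatin L → ∀ {b b′ c c′} → b ≡ b′ → L b c ≡ L b′ c′ → c ≡ c′
row-injective-cong l refl = row-injective l _ _ _

-- For Latin squares c ≡ c′ already forces b ≡ b′, as columns are bijective.
Orthogonal : ∀ {v} → Square v → Square v → Set
Orthogonal L M = ∀ b c b′ c′ → L b c ≡ L b′ c′ → M b c ≡ M b′ c′ → c ≡ c′

OrthogonalLatinPair : ℕ → Set
OrthogonalLatinPair v = Σ (Square v) λ L → Σ (Square v) λ M → IsLatin L × IsLatin M × Orthogonal L M

-- Direct products of squares

infixr 7 _⊗_

_⊗_ : ∀ {m n} → Square m → Square n → Square (m * n)
_⊗_ {m} {n} L L′ b c = combine (L (quotient {m} n b) (quotient {m} n c)) (L′ (remainder {m} n b) (remainder {m} n c))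

remQuot-injective : ∀ m n (i j : Fin (m * n)) → quotient {m} n i ≡ quotient {m} n j → remainder {m} n i ≡ remainder {m} n j → i ≡ j
remQuot-injective m n i j q r =
  trans (sym (combine-remQuot {m} n i)) (trans (cong₂ combine q r) (combine-remQuot {m} n j))

⊗-isLatin : ∀ {m n} {L : Square m} {L′ : Square n} → IsLatin L → IsLatin L′ → IsLatin (L ⊗ L′)
⊗-isLatin {m} {n} {L} {L′} l l′ = latin inj surj
  where
  inj : ∀ b c c′ → (L ⊗ L′) b c ≡ (L ⊗ L′) b c′ → c ≡ c′
  inj b c c′ eq with q , r ← combine-injective _ _ _ _ eq =
    remQuot-injective m n c c′ (row-injective l _ _ _ q) (row-injective l′ _ _ _ r)

  surj : ∀ c y → ∃ λ b → (L ⊗ L′) b c ≡ y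
  surj c y
    with b₁ , eq₁ ← column-surjective l (quotient {m} n c) (quotient {m} n y)
       | b₂ , eq₂ ← column-surjective l′ (remainder {m} n c) (remainder {m} n y) =
    combine b₁ b₂ , (begin
      (L ⊗ L′) (combine b₁ b₂) c
        ≡⟨ cong (λ (x , z) → combine (L x (quotient {m} n c)) (L′ z (remainder {m} n c))) (remQuot-combine b₁ b₂) ⟩
      combine (L b₁ (quotient {m} n c)) (L′ b₂ (remainder {m} n c))
        ≡⟨ cong₂ combine eq₁ eq₂ ⟩
      combine (quotient {m} n y) (remainder {m} n y)
        ≡⟨ combine-remQuot {m} n y ⟩
      y ∎)
    where open ≡-Reasoning

-- Equal entries of a product split into equal entries of both factors, so each factor recovers its
-- own coordinate of `c`.
⊗-orthogonal : ∀ {m n} {L M : Square m} {L′ M′ : Square n} →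
               Orthogonal L M → Orthogonal L′ M′ → Orthogonal (L ⊗ L′) (M ⊗ M′)
⊗-orthogonal {m} {n} o o′ b c b′ c′ eqL eqM
  with q , r ← combine-injective _ _ _ _ eqL | q′ , r′ ← combine-injective _ _ _ _ eqM =
  remQuot-injective m n c c′ (o _ _ _ _ q q′) (o′ _ _ _ _ r r′)

orthogonalLatinPair-* : ∀ {m n} → OrthogonalLatinPair m → OrthogonalLatinPair n → OrthogonalLatinPair (m * n)
orthogonalLatinPair-* (L , M , l , m , o) (L′ , M′ , l′ , m′ , o′) =
  L ⊗ L′ , M ⊗ M′ , ⊗-isLatin l l′ , ⊗-isLatin m m′ , ⊗-orthogonal o o′

-- The fields of order 4 and 8

add₂ : Square 2
add₂ zero       c          = c
add₂ (suc zero) zero       = suc zero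
add₂ (suc zero) (suc zero) = zero

add₂-isLatin : IsLatin add₂
add₂-isLatin = latin
  (from-yes (all? λ b → all? λ c → all? λ c′ → (add₂ b c ≟ add₂ b c′) →-dec (c ≟ c′)))
  (from-yes (all? λ c → all? λ y → any? λ b → add₂ b c ≟ y))

-- Turns b + c into b + xc: multiplication by x only permutes the columns.
∘-isLatin : ∀ {v} {L : Square v} (π π⁻¹ : Fin v → Fin v) → (∀ c → π⁻¹ (π c) ≡ c) →
            IsLatin L → IsLatin (λ b c → L b (π c))
∘-isLatin π π⁻¹ inverse l = latin
  (λ b c c′ eq → trans (sym (inverse c)) (trans (cong π⁻¹ (row-injective l b _ _ eq)) (inverse c′)))
  (λ c → column-surjective l (π c))

-- `combine` puts its first argument in the higher digit, so this is binary addition without carry,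
-- the addition of the field.
add₄ : Square 4
add₄ = add₂ ⊗ add₂

-- Multiplication by x in 𝔽₂[x]/(x² + x + 1), a polynomial being read as the binary number of its coefficients.
mul₄ mul₄⁻¹ : Fin 4 → Fin 4
mul₄   = lookup (# 0 ∷ # 2 ∷ # 3 ∷ # 1 ∷ [])
mul₄⁻¹ = lookup (# 0 ∷ # 3 ∷ # 1 ∷ # 2 ∷ [])

orthogonalLatinPair-4 : OrthogonalLatinPair 4
orthogonalLatinPair-4 = add₄ , (λ b c → add₄ b (mul₄ c)) , add₄-isLatin ,
  ∘-isLatin mul₄ mul₄⁻¹ (from-yes (all? λ c → mul₄⁻¹ (mul₄ c) ≟ c)) add₄-isLatin ,
  -- Decided by exhaustion. The reason is that b + c and b + xc add up to (x + 1)c, and x + 1 is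
  -- invertible.
  from-yes (all? λ b → all? λ c → all? λ b′ → all? λ c′ →
    (add₄ b c ≟ add₄ b′ c′) →-dec (add₄ b (mul₄ c) ≟ add₄ b′ (mul₄ c′)) →-dec (c ≟ c′))
  where
  add₄-isLatin : IsLatin add₄
  add₄-isLatin = ⊗-isLatin add₂-isLatin add₂-isLatin

add₈ : Square 8
add₈ = add₂ ⊗ add₄

-- Multiplication by x in 𝔽₂[x]/(x³ + x + 1).
mul₈ mul₈⁻¹ : Fin 8 → Fin 8
mul₈   = lookup (# 0 ∷ # 2 ∷ # 4 ∷ # 6 ∷ # 3 ∷ # 1 ∷ # 7 ∷ # 5 ∷ [])
mul₈⁻¹ = lookup (# 0 ∷ # 5 ∷ # 1 ∷ # 4 ∷ # 2 ∷ # 7 ∷ # 3 ∷ # 6 ∷ [])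

orthogonalLatinPair-8 : OrthogonalLatinPair 8
orthogonalLatinPair-8 = add₈ , (λ b c → add₈ b (mul₈ c)) , add₈-isLatin ,
  ∘-isLatin mul₈ mul₈⁻¹ (from-yes (all? λ c → mul₈⁻¹ (mul₈ c) ≟ c)) add₈-isLatin ,
  from-yes (all? λ b → all? λ c → all? λ b′ → all? λ c′ →
    (add₈ b c ≟ add₈ b′ c′) →-dec (add₈ b (mul₈ c) ≟ add₈ b′ (mul₈ c′)) →-dec (c ≟ c′))
  where
  add₈-isLatin : IsLatin add₈
  add₈-isLatin = ⊗-isLatin add₂-isLatin (⊗-isLatin add₂-isLatin add₂-isLatin)

-- Congruences

module _ (n : ℕ) .{{_ : NonZero n}} where

  +-cong-% : ∀ x x′ y y′ → x % n ≡ x′ % n → y % n ≡ y′ % n → (x + y) % n ≡ (x′ + y′) % n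
  +-cong-% x x′ y y′ p q =
    trans (%-distribˡ-+ x y n) (trans (cong₂ (λ a b → (a + b) % n) p q) (sym (%-distribˡ-+ x′ y′ n)))

  *-congˡ-% : ∀ k y y′ → y % n ≡ y′ % n → (k * y) % n ≡ (k * y′) % n
  *-congˡ-% k y y′ q =
    trans (%-distribˡ-* k y n) (trans (cong (λ b → (k % n * b) % n) q) (sym (%-distribˡ-* k y′ n)))

  toℕ-mod : ∀ x → toℕ (x mod n) ≡ x % n
  toℕ-mod x = toℕ-fromℕ< (m%n<n x n)

  toℕ-injective-% : ∀ (i j : Fin n) → toℕ i % n ≡ toℕ j % n → i ≡ j
  toℕ-injective-% i j eq = toℕ-injective
    (trans (sym (m<n⇒m%n≡m (toℕ<n i))) (trans eq (m<n⇒m%n≡m (toℕ<n j))))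

  mod-≡⇒%-≡ : ∀ x y → x mod n ≡ y mod n → x % n ≡ y % n
  mod-≡⇒%-≡ x y eq = trans (sym (toℕ-mod x)) (trans (cong toℕ eq) (toℕ-mod y))

module _ (n : ℕ) where

  private
    v : ℕ
    v = suc n

  -- n ≡ -1 modulo suc n
  neg-+-cancel : ∀ x y → (n * x + (x + y)) % v ≡ y % v
  neg-+-cancel x y = trans (cong (_% v) (identity n x y)) ([m+kn]%n≡m%n y x v)
    where
    identity : ∀ n x y → n * x + (x + y) ≡ y + x * suc n
    identity = solve-∀

  -- Adding `n * x` acts as subtracting `x`, which avoids truncated subtraction.
  +-cancelˡ-% : ∀ x x′ y y′ → x % v ≡ x′ % v → (x + y) % v ≡ (x′ + y′) % v → y % v ≡ y′ % v
  +-cancelˡ-% x x′ y y′ p q = begin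
    y % v                       ≡⟨ neg-+-cancel x y ⟨
    (n * x + (x + y)) % v       ≡⟨ +-cong-% v (n * x) (n * x′) (x + y) (x′ + y′) (*-congˡ-% v n x x′ p) q ⟩
    (n * x′ + (x′ + y′)) % v    ≡⟨ neg-+-cancel x′ y′ ⟩
    y′ % v                      ∎
    where open ≡-Reasoning

  affine : ℕ → Square v
  affine k b c = (toℕ b + k * toℕ c) mod v

  affine-≡⇒%-≡ : ∀ k b c b′ c′ → affine k b c ≡ affine k b′ c′ →
                 (toℕ b + k * toℕ c) % v ≡ (toℕ b′ + k * toℕ c′) % v
  affine-≡⇒%-≡ k b c b′ c′ = mod-≡⇒%-≡ v (toℕ b + k * toℕ c) (toℕ b′ + k * toℕ c′)

  -- A row is a translate of multiplication by `k`, injective by the cancellation hypothesis; a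
  -- column is a translation.
  affine-isLatin : ∀ k → (∀ x y → (k * x) % v ≡ (k * y) % v → x % v ≡ y % v) → IsLatin (affine k)
  affine-isLatin k cancel = latin
    (λ b c c′ eq → toℕ-injective-% v c c′ (cancel (toℕ c) (toℕ c′)
      (+-cancelˡ-% (toℕ b) (toℕ b) (k * toℕ c) (k * toℕ c′) refl (affine-≡⇒%-≡ k b c b c′ eq))))
    surj
    where
    surj : ∀ c y → ∃ λ b → affine k b c ≡ y
    surj c y = z mod v , toℕ-injective-% v _ y (begin
      toℕ (affine k (z mod v) c) % v    ≡⟨ cong (_% v) (toℕ-mod v (toℕ (z mod v) + x)) ⟩
      (toℕ (z mod v) + x) % v % v       ≡⟨ m%n%n≡m%n (toℕ (z mod v) + x) v ⟩
      (toℕ (z mod v) + x) % v           ≡⟨ cong (λ w → (w + x) % v) (toℕ-mod v z) ⟩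
      (z % v + x) % v                   ≡⟨ +-cong-% v (z % v) z x x (m%n%n≡m%n z v) refl ⟩
      (z + x) % v                       ≡⟨ cong (_% v) (identity n x (toℕ y)) ⟩
      (n * x + (x + toℕ y)) % v         ≡⟨ neg-+-cancel x (toℕ y) ⟩
      toℕ y % v                         ∎)
      where
      open ≡-Reasoning
      x z : ℕ
      x = k * toℕ c
      -- This is y - kc modulo `v`, with `n` standing for -1.
      z = n * x + toℕ y
      identity : ∀ n x y → n * x + y + x ≡ n * x + (x + y)
      identity = solve-∀

  -- The two linear forms differ by c, so cancelling the first congruence from the second leaves c
  -- and c′ congruent.
  affine-orthogonal : ∀ k → Orthogonal (affine k) (affine (suc k))
  affine-orthogonal k b c b′ c′ eq eq′ = toℕ-injective-% v c c′
    (+-cancelˡ-% (toℕ b + k * toℕ c) (toℕ b′ + k * toℕ c′) (toℕ c) (toℕ c′) (affine-≡⇒%-≡ k b c b′ c′ eq)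
      (trans (cong (_% v) (identity k (toℕ b) (toℕ c)))
        (trans (affine-≡⇒%-≡ (suc k) b c b′ c′ eq′) (cong (_% v) (sym (identity k (toℕ b′) (toℕ c′)))))))
    where
    identity : ∀ k b c → b + k * c + c ≡ b + suc k * c
    identity = solve-∀

-- 1 + h is the inverse of 2 modulo 1 + 2h.
2*-cancel-% : ∀ h x y → (2 * x) % suc (2 * h) ≡ (2 * y) % suc (2 * h) → x % suc (2 * h) ≡ y % suc (2 * h)
2*-cancel-% h x y eq = trans (sym (halve x)) (trans (*-congˡ-% (suc (2 * h)) (suc h) (2 * x) (2 * y) eq) (halve y))
  where
  identity : ∀ h x → suc h * (2 * x) ≡ x + x * suc (2 * h)
  identity = solve-∀

  halve : ∀ x → (suc h * (2 * x)) % suc (2 * h) ≡ x % suc (2 * h)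
  halve x = trans (cong (_% suc (2 * h)) (identity h x)) ([m+kn]%n≡m%n x x (suc (2 * h)))

-- Orthogonal pairs of every admissible order

orthogonalLatinPair-odd : ∀ h → OrthogonalLatinPair (suc (2 * h))
orthogonalLatinPair-odd h =
  affine (2 * h) 1 , affine (2 * h) 2 ,
  affine-isLatin (2 * h) 1 (λ x y → subst₂ (λ x′ y′ → x′ % suc (2 * h) ≡ y′ % suc (2 * h)) (*-identityˡ x) (*-identityˡ y)) ,
  affine-isLatin (2 * h) 2 (2*-cancel-% h) ,
  affine-orthogonal (2 * h) 1

-- Odd orders are covered directly. For v = 4w a factor 4 is split off and the induction continues
-- with w, as long as w is itself admissible.
orthogonalLatinPair : ∀ v → v % 4 ≢ 2 → OrthogonalLatinPair v
orthogonalLatinPair = <-rec _ step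
  where
  step : ∀ v → (∀ {w} → w < v → w % 4 ≢ 2 → OrthogonalLatinPair w) → v % 4 ≢ 2 → OrthogonalLatinPair v
  step zero _ _ = (λ ()) , (λ ()) , latin (λ ()) (λ ()) , latin (λ ()) (λ ()) , λ ()
  step v@(suc _) rec v%4≢2 with v % 4 | v / 4 | m≡m%n+[m/n]*n v 4 | m%n<n v 4
  ... | 1 | q | eq | _ = subst OrthogonalLatinPair (sym (trans eq (identity q))) (orthogonalLatinPair-odd (2 * q))
    where
    identity : ∀ q → 1 + q * 4 ≡ suc (2 * (2 * q))
    identity = solve-∀
  ... | 2 | _ | _ | _ = contradiction refl v%4≢2
  ... | 3 | q | eq | _ = subst OrthogonalLatinPair (sym (trans eq (identity q))) (orthogonalLatinPair-odd (suc (2 * q)))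
    where
    identity : ∀ q → 3 + q * 4 ≡ suc (2 * suc (2 * q))
    identity = solve-∀
  ... | suc (suc (suc (suc _))) | _ | _ | s<s (s<s (s<s (s<s ())))
  ... | 0 | w@(suc _) | eq | _ with w % 4 ℕ.≟ 2
  ...   | no w%4≢2 = subst OrthogonalLatinPair (trans (*-comm 4 w) (sym eq))
                       (orthogonalLatinPair-* orthogonalLatinPair-4
                         (rec (subst (w <_) (sym eq) (m<m*n w 4 (s<s z<s))) w%4≢2))
  -- The induction hypothesis does not apply to `w`, but w is twice an odd number, so v is 8 times
  -- that number.
  ...   | yes w%4≡2 = subst OrthogonalLatinPair v≡8*odd
                        (orthogonalLatinPair-* orthogonalLatinPair-8 (orthogonalLatinPair-odd (w / 4)))
    where
    identity : ∀ q → 8 * suc (2 * q) ≡ (2 + q * 4) * 4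
    identity = solve-∀
    v≡8*odd : 8 * suc (2 * (w / 4)) ≡ v
    v≡8*odd = begin
      8 * suc (2 * (w / 4))     ≡⟨ identity (w / 4) ⟩
      (2 + w / 4 * 4) * 4       ≡⟨ cong (λ r → (r + w / 4 * 4) * 4) w%4≡2 ⟨
      (w % 4 + w / 4 * 4) * 4   ≡⟨ cong (_* 4) (m≡m%n+[m/n]*n w 4) ⟨
      w * 4                     ≡⟨ eq ⟨
      v                         ∎
      where open ≡-Reasoning

-- The array

module _ {v} (L M : Square v) where

  row : Fin v → Fin v → Fin v → Vec (Fin v) 6
  row a b c = a ∷ b ∷ L a c ∷ L b c ∷ a ∷ M b c ∷ []

  -- In any two adjacent columns, one entry depends only on a and c, the other only on b and c. For
  -- fixed c the two equations are therefore solved separately.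
  row-solve : IsLatin L → IsLatin M → ∀ c (T : Interaction 2 6 v) →
              ∃₂ λ a b → ∀ s → lookup (row a b c) (column (start T) s) ≡ lookup (values T) s
  row-solve l m c (interaction zero (x ∷ y ∷ [])) = x , y , λ { zero → refl ; (suc zero) → refl }
  row-solve l m c (interaction (suc zero) (x ∷ y ∷ [])) with a , eq ← column-surjective l c y =
    a , x , λ { zero → refl ; (suc zero) → eq }
  row-solve l m c (interaction (suc (suc zero)) (x ∷ y ∷ []))
    with a , eq ← column-surjective l c x | b , eq′ ← column-surjective l c y =
    a , b , λ { zero → eq ; (suc zero) → eq′ }
  row-solve l m c (interaction (suc (suc (suc zero))) (x ∷ y ∷ [])) with b , eq ← column-surjective l c x =
    y , b , λ { zero → eq ; (suc zero) → refl }
  row-solve l m c (interaction (suc (suc (suc (suc zero)))) (x ∷ y ∷ [])) with b , eq ← column-surjective m c y =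
    x , b , λ { zero → refl ; (suc zero) → eq }

  module _ (a b c a′ b′ c′ : Fin v) where

    -- What follows when both rows contain one interaction starting at `i`, whatever its values.
    Agree : Fin 5 → Set
    Agree i = ∀ s → lookup (row a b c) (column {2} {6} i s) ≡ lookup (row a′ b′ c′) (column {2} {6} i s)

    module _ (l : IsLatin L) (m : IsLatin M) (o : Orthogonal L M) where

      -- In all cases but one, the columns involved show a or b together with an entry of a Latin
      -- square in the row of that symbol, and row injectivity yields c.
      agree⇒class-≡-< : ∀ i j → i Fin.< j → Agree i → Agree j → c ≡ c′
      agree⇒class-≡-< zero (suc zero) _ p q = row-injective-cong l (p (# 0)) (q (# 1))
      agree⇒class-≡-< zero (suc (suc zero)) _ p q = row-injective-cong l (p (# 0)) (q (# 0))
      agree⇒class-≡-< zero (suc (suc (suc zero))) _ p q = row-injective-cong l (p (# 1)) (q (# 0))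
      agree⇒class-≡-< zero (suc (suc (suc (suc zero)))) _ p q = row-injective-cong m (p (# 1)) (q (# 1))
      agree⇒class-≡-< (suc zero) (suc (suc zero)) _ p q = row-injective-cong l (p (# 0)) (q (# 1))
      agree⇒class-≡-< (suc zero) (suc (suc (suc zero))) _ p q = row-injective-cong l (p (# 0)) (q (# 0))
      agree⇒class-≡-< (suc zero) (suc (suc (suc (suc zero)))) _ p q = row-injective-cong l (q (# 0)) (p (# 1))
      agree⇒class-≡-< (suc (suc zero)) (suc (suc (suc zero))) _ p q = row-injective-cong l (q (# 1)) (p (# 0))
      agree⇒class-≡-< (suc (suc zero)) (suc (suc (suc (suc zero)))) _ p q = row-injective-cong l (q (# 0)) (p (# 0))
      -- The last three columns hold L(b,c), a, M(b,c): neither L(a,c) nor b is visible, and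
      -- orthogonality takes over.
      agree⇒class-≡-< (suc (suc (suc zero))) (suc (suc (suc (suc zero)))) _ p q = o b c b′ c′ (p (# 0)) (q (# 1))
      agree⇒class-≡-< (suc zero) (suc zero) (s<s ()) _ _
      agree⇒class-≡-< (suc (suc zero)) (suc zero) (s<s ()) _ _
      agree⇒class-≡-< (suc (suc zero)) (suc (suc zero)) (s<s (s<s ())) _ _
      agree⇒class-≡-< (suc (suc (suc zero))) (suc zero) (s<s ()) _ _
      agree⇒class-≡-< (suc (suc (suc zero))) (suc (suc zero)) (s<s (s<s ())) _ _
      agree⇒class-≡-< (suc (suc (suc zero))) (suc (suc (suc zero))) (s<s (s<s (s<s ()))) _ _
      agree⇒class-≡-< (suc (suc (suc (suc zero)))) (suc (suc (suc (suc zero)))) (s<s (s<s (s<s (s<s ())))) _ _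

      agree⇒class-≡ : ∀ i j → i ≢ j → Agree i → Agree j → c ≡ c′
      agree⇒class-≡ i j i≢j p q with <-cmp i j
      ... | tri< i<j _ _ = agree⇒class-≡-< i j i<j p q
      ... | tri≈ _ i≡j _ = contradiction i≡j i≢j
      ... | tri> _ _ j<i = agree⇒class-≡-< j i j<i q p

-- `v ^ 2` unfolds to `v * (v * 1)`, so the index has a last digit in `Fin 1`, namely `zero`.
rowIndex : ∀ {v n} → Fin v → Fin v → Fin n → Fin (n * v ^ 2)
rowIndex a b c = combine c (combine a (combine b zero))

rowLabel : ∀ {v n} → Fin (n * v ^ 2) → Fin n × Fin v × Fin v
rowLabel {v} {n} = map₂ (map₂ (quotient (v ^ 0)) ∘ remQuot {v} (v ^ 1)) ∘ remQuot {n} (v ^ 2)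

rowLabel-rowIndex : ∀ {v n} a b c → rowLabel {v} {n} (rowIndex a b c) ≡ (c , a , b)
rowLabel-rowIndex {v} {n} a b c = trans
  (cong (map₂ (map₂ (quotient (v ^ 0)) ∘ remQuot {v} (v ^ 1))) (remQuot-combine {n} {v ^ 2} c (combine a (combine b zero))))
  (cong (c ,_) (trans
    (cong (map₂ (quotient (v ^ 0))) (remQuot-combine {v} {v ^ 1} a (combine b zero)))
    (cong (λ p → a , proj₁ p) (remQuot-combine {v} {v ^ 0} b zero))))

module _ {v n} (L M : Square v) (n≤v : n ≤ v) where

  -- The values of c used are the first `n` symbols, available because `n ≤ v`.
  array : Array (n * v ^ 2) 6 v
  array r = let c , a , b = rowLabel {v} {n} r in lookup (row L M a b (inject≤ c n≤v))

  array-rowIndex : ∀ a b c → array (rowIndex {v} {n} a b c) ≡ lookup (row L M a b (inject≤ c n≤v))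
  array-rowIndex a b c = cong (λ (c , a , b) → lookup (row L M a b (inject≤ c n≤v))) (rowLabel-rowIndex {v} {n} a b c)

array-isCDA : ∀ {v d} (L M : Square v) (d+1≤v : d + 1 ≤ v) → IsLatin L → IsLatin M → Orthogonal L M →
              IsCDA d 2 (array L M d+1≤v)
array-isCDA {v} {d} L M d+1≤v l m o = isCDA A rows rows-ρ separated
  where
  A : Array ((d + 1) * v ^ 2) 6 v
  A = array L M d+1≤v

  class : Fin (d + 1) → Fin v
  class i = inject≤ i d+1≤v

  a b : Interaction 2 6 v → Fin (d + 1) → Fin v
  a T i = proj₁ (row-solve L M l m (class i) T)
  b T i = proj₁ (proj₂ (row-solve L M l m (class i) T))

  rows : Interaction 2 6 v → Fin (d + 1) → Fin ((d + 1) * v ^ 2)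
  rows T i = rowIndex {v} {d + 1} (a T i) (b T i) i

  A-rows : ∀ T i j → A (rows T i) j ≡ lookup (row L M (a T i) (b T i) (class i)) j
  A-rows T i = cong-app (array-rowIndex L M d+1≤v (a T i) (b T i) i)

  rows-ρ : ∀ T i → ρ A T (rows T i)
  rows-ρ T i s = trans (A-rows T i (column (start T) s)) (proj₂ (proj₂ (row-solve L M l m (class i) T)) s)

  separated : ∀ T T′ i j → start T ≢ start T′ → ρ A T′ (rows T i) → ρ A T′ (rows T j) → i ≡ j
  -- Rows i and j share `T` by construction and `T′` by assumption, so they agree at two different
  -- starts and have the same c.
  separated T T′ i j T≢T′ p q = inject≤-injective d+1≤v d+1≤v i j
    (agree⇒class-≡ L M (a T i) (b T i) (class i) (a T j) (b T j) (class j) l m o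
      (start T) (start T′) T≢T′ (agree T (rows-ρ T i) (rows-ρ T j)) (agree T′ p q))
    where
    agree : ∀ T″ → ρ A T″ (rows T i) → ρ A T″ (rows T j) →
            Agree L M (a T i) (b T i) (class i) (a T j) (b T j) (class j) (start T″)
    agree T″ p q s = trans (sym (A-rows T i (column (start T″) s)))
      (trans (p s) (trans (sym (q s)) (A-rows T j (column (start T″) s))))

mainTheorem12 : (v : ℕ) → 4 ≤ v → v % 4 ≢ 2 → (d : ℕ) → 1 ≤ d → d + 1 ≤ v → Σ (Array ((d + 1) * v ^ 2) 6 v) (λ A → IsOptimumCDA d 2 A)
mainTheorem12 v _ v%4≢2 d _ d+1≤v with L , M , l , m , o ← orthogonalLatinPair v v%4≢2 =
  array L M d+1≤v , array-isCDA L M d+1≤v l m o , refl
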